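{- For each integer $n\ge 0$, $$\widetilde{\sigma}_{5}(n)=-48\sum_{\substack{i,j\ge 0\\ i+j=n}}\widehat{\sigma}(i)\,\widetilde{\sigma}_{3}(j),$$ where $\widetilde{\sigma}_{5}(0)=\tfrac18$, $\widehat{\sigma}(0)=\tfrac1{24}$ and $\widetilde{\sigma}_{3}(0)=-\tfrac1{16}$.
   Context: For integers $n\ge1$, $\widetilde{\sigma}_{s}(n)=\sum_{d\mid n}(-1)^{d-1}d^{s}$ and $\widehat{\sigma}(n)=\widehat{\sigma}_{1}(n)=\sum_{d\mid n}(-1)^{n/d-1}d$. Values at $n=0$ are assigned as in the claim. -}

module Defs where

open import Data.Integer using (ℤ; +_; -[1+_])
import Data.Integer as ℤ
open import Data.List using (List; map; filter; upTo; foldr)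
open import Data.Nat using (ℕ; zero; suc; _∸_)
import Data.Nat as ℕ
open import Data.Nat.Divisibility using (_∣?_)
open import Data.Product using (_×_; _,_)
open import Data.Rational using (ℚ; 0ℚ; _/_)
import Data.Rational as ℚ

sumℤ : List ℤ → ℤ
sumℤ = foldr ℤ._+_ (+ 0)

sumℚ : List ℚ → ℚ
sumℚ = foldr ℚ._+_ 0ℚ

-- For n ≥ 1, the list of all d - 1 with d a positive divisor of n.  Storing
-- predecessors makes every divisor syntactically nonzero; it is recovered as
-- suc k.  For n = 0 the list is empty, and that value is never used below.
divisorPreds : ℕ → List ℕ
divisorPreds n = filter (λ k → suc k ∣? n) (upTo n)

-1^_ : ℕ → ℤ
-1^ k = -[1+ 0 ] ℤ.^ k

-- σ-tilde s n = Σ_{d ∣ n} (-1)^(d-1) d^s   (n ≥ 1), with d = suc k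
σ-tilde : ℕ → ℕ → ℤ
σ-tilde s n = sumℤ (map (λ k → (-1^ (suc k ∸ 1)) ℤ.* (+ suc k) ℤ.^ s) (divisorPreds n))

-- σ-hat n = Σ_{d ∣ n} (-1)^(n/d-1) d   (n ≥ 1), with d = suc k;
-- here n/d ≥ 1, so the truncated subtraction is exact.
σ-hat : ℕ → ℤ
σ-hat n = sumℤ (map (λ k → (-1^ (n ℕ./ suc k ∸ 1)) ℤ.* (+ suc k)) (divisorPreds n))

-- The same functions on all n ≥ 0, with their conventional constant terms.
σ-tilde₅ : ℕ → ℚ
σ-tilde₅ zero    = + 1 / 8
σ-tilde₅ (suc m) = σ-tilde 5 (suc m) / 1

σ-hat₁ : ℕ → ℚ
σ-hat₁ zero    = + 1 / 24
σ-hat₁ (suc m) = σ-hat (suc m) / 1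

σ-tilde₃ : ℕ → ℚ
σ-tilde₃ zero    = -[1+ 0 ] / 16
σ-tilde₃ (suc m) = σ-tilde 3 (suc m) / 1

-- All pairs (i , j) of naturals with i + j = n, each exactly once.
antidiagonal : ℕ → List (ℕ × ℕ)
antidiagonal n = map (λ i → i , n ∸ i) (upTo (suc n))

{-# OPTIONS --safe #-}

-- Weight the positive solutions of a x + b y = n by
--   c₁ = (-1)^(x+b),  c₂ = (-1)^(y+a),  c₃ = (-1)^(x+y+a+b).
-- Substituting y + x for y, or a + b for a, turns the solutions with y > x, or with
-- a > b, into the positive solutions of (a+b) x + b y = n; this identifies
--   F = c₁ b²(2a+b)² + c₂ a²(2b+a)² + c₃ (a²-b²)²   on y > x   with
--   G = c₁ b²(2a-b)² + c₂ a²(2b-a)² + c₃ (a²-b²)²   on a > b.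
-- Both are symmetric under (a,x) ↔ (b,y), so their sums over all solutions differ
-- only by the diagonals x = y (for F) and a = b (for G).  But F - G = 8(c₁ab³ + c₂a³b),
-- and c₁ab³ is the summand of the convolution of σ-hat and σ-tilde 3; the
-- diagonals are divisor sums with closed forms.
module Submission where

open import Defs
open import Data.Bool using (if_then_else_)
open import Data.Integer using (ℤ; +_; -_; 0ℤ; 1ℤ; -1ℤ)
import Data.Integer as ℤ
open import Data.Integer.Tactic.RingSolver using (solve-∀)
open import Data.List using ([]; _∷_; map; filter; upTo; applyUpTo)
open import Data.List.Properties using (map-∘; map-upTo)
open import Data.Nat using (ℕ; zero; suc; pred; _≤_; _<_; _≟_; s≤s; z≤n)
import Data.Nat as ℕ
open import Data.Nat.Divisibility using (_∣_; _∣?_; divides)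
open import Data.Nat.DivMod using (m*n/n≡m)
import Data.Nat.Properties as ℕ
open import Data.Nat.Tactic.RingSolver using () renaming (solve-∀ to solveℕ-∀)
open import Data.Product using (_,_; uncurry)
open import Data.Rational using (ℚ; toℚᵘ; _/_)
import Data.Rational as ℚ
import Data.Rational.Properties as ℚ
open import Data.Rational.Solver using (module +-*-Solver)
open import Data.Rational.Unnormalised using (mkℚᵘ; *≡*)
import Data.Rational.Unnormalised as ℚᵘ
import Data.Rational.Unnormalised.Properties as ℚᵘ
open import Function using (flip; _∘_)
open import Relation.Binary.PropositionalEquality using (_≡_; _≢_; refl; sym; trans; cong; cong₂; subst; module ≡-Reasoning)
open import Relation.Nullary using (Dec; yes; no; does; contradiction)
open import Relation.Unary using (Decidable)

open ≡-Reasoning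

-- The identity for positive `n`, over the integers, beginning with finite sums.

module Integral where
  open import Data.Integer using (_+_; _*_)
  open import Data.Integer.Properties using (+-identityˡ; +-identityʳ; *-identityˡ; *-zeroˡ; *-zeroʳ; *-comm; +-assoc; *-distribˡ-+; ^-distribˡ-+-*; pos-+; *-cancelˡ-≡)

  -- The summation index runs from 1 to n.
  ∑ : ℕ → (ℕ → ℤ) → ℤ
  ∑ zero    f = 0ℤ
  ∑ (suc n) f = ∑ n f + f (suc n)

  ∑-cong-≤ : ∀ n {f g : ℕ → ℤ} → (∀ k → k < n → f (suc k) ≡ g (suc k)) → ∑ n f ≡ ∑ n g
  ∑-cong-≤ zero    eq = refl
  ∑-cong-≤ (suc n) eq = cong₂ _+_ (∑-cong-≤ n λ k k<n → eq k (ℕ.m<n⇒m<1+n k<n)) (eq n ℕ.≤-refl)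

  ∑-cong : ∀ n {f g : ℕ → ℤ} → (∀ k → f (suc k) ≡ g (suc k)) → ∑ n f ≡ ∑ n g
  ∑-cong n eq = ∑-cong-≤ n λ k _ → eq k

  ∑-zero : ∀ n {f : ℕ → ℤ} → (∀ k → f (suc k) ≡ 0ℤ) → ∑ n f ≡ 0ℤ
  ∑-zero zero    eq = refl
  ∑-zero (suc n) eq = cong₂ _+_ (∑-zero n eq) (eq n)

  ∑-distrib-+ : ∀ n (f g : ℕ → ℤ) → ∑ n (λ k → f k + g k) ≡ ∑ n f + ∑ n g
  ∑-distrib-+ zero    f g = refl
  ∑-distrib-+ (suc n) f g = trans (cong (_+ (f (suc n) + g (suc n))) (∑-distrib-+ n f g))
    (interchange (∑ n f) (∑ n g) (f (suc n)) (g (suc n)))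
    where
    interchange : ∀ u v w z → u + v + (w + z) ≡ u + w + (v + z)
    interchange = solve-∀

  *-distribˡ-∑ : ∀ n c (f : ℕ → ℤ) → c * ∑ n f ≡ ∑ n (λ k → c * f k)
  *-distribˡ-∑ zero    c f = *-zeroʳ c
  *-distribˡ-∑ (suc n) c f = trans (*-distribˡ-+ c (∑ n f) (f (suc n))) (cong (_+ c * f (suc n)) (*-distribˡ-∑ n c f))

  ∑-swap : ∀ m n (f : ℕ → ℕ → ℤ) → ∑ m (λ i → ∑ n (f i)) ≡ ∑ n (λ j → ∑ m (λ i → f i j))
  ∑-swap zero    n f = sym (∑-zero n {λ _ → 0ℤ} λ _ → refl)
  ∑-swap (suc m) n f = trans (cong (_+ ∑ n (f (suc m))) (∑-swap m n f))
    (sym (∑-distrib-+ n (λ j → ∑ m (λ i → f i j)) (f (suc m))))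

  ∑-head : ∀ n (f : ℕ → ℤ) → ∑ (suc n) f ≡ f 1 + ∑ n (λ k → f (suc k))
  ∑-head zero    f = trans (+-identityˡ (f 1)) (sym (+-identityʳ (f 1)))
  ∑-head (suc n) f = trans (cong (_+ f (2 ℕ.+ n)) (∑-head n f)) (+-assoc (f 1) (∑ n (λ k → f (suc k))) (f (2 ℕ.+ n)))

  ∑-single : ∀ n {f : ℕ → ℤ} q → q < n → (∀ k → k ≢ q → f (suc k) ≡ 0ℤ) → ∑ n f ≡ f (suc q)
  ∑-single (suc n) {f} q q<1+n vanish with q ≟ n
  ... | yes refl = trans (cong (_+ f (suc n)) (trans (∑-cong-≤ n λ k k<n → vanish k (ℕ.<⇒≢ k<n)) (∑-zero n {λ _ → 0ℤ} λ _ → refl)))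
                         (+-identityˡ (f (suc n)))
  ... | no  q≢n  = trans (cong₂ _+_ (∑-single n q (ℕ.≤∧≢⇒< (ℕ.≤-pred q<1+n) q≢n) vanish) (vanish n λ n≡q → q≢n (sym n≡q)))
                         (+-identityʳ (f (suc q)))

  -- Enlarging the square by one adds a row, a column and a corner; these go to the part where the
  -- first index is larger, the part where the second is larger, and the diagonal, in this order.
  -- The bound `pred m` makes the inequalities strict.
  ∑-square : ∀ N (h : ℕ → ℕ → ℤ) →
    ∑ N (λ a → ∑ N (h a)) ≡
    ∑ N (λ k → h k k) + (∑ N (λ m → ∑ (pred m) (λ b → h m b)) + ∑ N (λ m → ∑ (pred m) (λ a → h a m)))
  ∑-square zero    h = refl
  ∑-square (suc N) h = begin
    ∑ N (λ a → ∑ N (h a) + h a (suc N)) + (r + e)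
      ≡⟨ cong (_+ (r + e)) (trans (∑-distrib-+ N (λ a → ∑ N (h a)) (λ a → h a (suc N))) (cong (_+ c) (∑-square N h))) ⟩
    d + (l + u) + c + (r + e)
      ≡⟨ rearrange d l u c r e ⟩
    (d + e) + ((l + r) + (u + c)) ∎
    where
    d = ∑ N (λ k → h k k)
    l = ∑ N (λ m → ∑ (pred m) (λ b → h m b))
    u = ∑ N (λ m → ∑ (pred m) (λ a → h a m))
    c = ∑ N (λ a → h a (suc N))
    r = ∑ N (h (suc N))
    e = h (suc N) (suc N)
    rearrange : ∀ d l u c r e → d + (l + u) + c + (r + e) ≡ (d + e) + ((l + r) + (u + c))
    rearrange = solve-∀

  -- Substitution `m = a + b`, with `a` the positive difference. The right side runs over a full
  -- square, so it also meets values `a + b > N`; `vanish` removes them. The induction peels off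
  -- `b = 1` and shifts both arguments of `g`.
  ∑-triangle : ∀ N (g : ℕ → ℕ → ℤ) → (∀ m b → N < m → g m b ≡ 0ℤ) →
    ∑ N (λ m → ∑ (pred m) (g m)) ≡ ∑ N (λ a → ∑ N (λ b → g (a ℕ.+ b) b))
  ∑-triangle zero    g vanish = refl
  ∑-triangle (suc N) g vanish = begin
    ∑ (suc N) (λ m → ∑ (pred m) (g m))
      ≡⟨ trans (∑-head N (λ m → ∑ (pred m) (g m))) (+-identityˡ (∑ N (λ m → ∑ m (g (suc m))))) ⟩
    ∑ N (λ m → ∑ m (g (suc m)))
      ≡⟨ ∑-cong N (λ m → ∑-head m (g (2 ℕ.+ m))) ⟩
    ∑ N (λ m → g (suc m) 1 + ∑ (pred m) (g′ m))
      ≡⟨ ∑-distrib-+ N (λ m → g (suc m) 1) (λ m → ∑ (pred m) (g′ m)) ⟩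
    first + ∑ N (λ m → ∑ (pred m) (g′ m))
      ≡⟨ cong (λ z → first + z) (∑-triangle N g′ λ m b N<m → vanish (suc m) (suc b) (s≤s N<m)) ⟩
    first + ∑ N (λ a → ∑ N (λ b → g′ (a ℕ.+ b) b))
      ≡⟨ ∑-distrib-+ N (λ a → g (suc a) 1) (λ a → ∑ N (λ b → g′ (a ℕ.+ b) b)) ⟨
    ∑ N (λ a → g (suc a) 1 + ∑ N (λ b → g′ (a ℕ.+ b) b))
      ≡⟨ ∑-cong N (λ a → sym (trans (∑-head N (λ b → g (suc a ℕ.+ b) b))
           (cong₂ _+_ (cong (λ m → g m 1) (ℕ.+-comm (suc a) 1))
                      (∑-cong N λ b → cong (λ m → g m (2 ℕ.+ b)) (ℕ.+-suc (suc a) (suc b)))))) ⟩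
    main
      ≡⟨ +-identityʳ main ⟨
    main + 0ℤ
      -- The missing row `a = suc N` may be added, because `a + b` exceeds `suc N` throughout it.
      ≡⟨ cong (λ z → main + z) (∑-zero (suc N) {λ b → g (suc N ℕ.+ b) b} λ b → vanish _ _ (ℕ.m<m+n (suc N) (s≤s z≤n))) ⟨
    ∑ (suc N) (λ a → ∑ (suc N) (λ b → g (a ℕ.+ b) b)) ∎
    where
    g′ : ℕ → ℕ → ℤ
    g′ m b = g (suc m) (suc b)
    first = ∑ N (λ m → g (suc m) 1)
    main  = ∑ N (λ a → ∑ (suc N) (λ b → g (a ℕ.+ b) b))

  ∑-trichotomy : ∀ N (h : ℕ → ℕ → ℤ) → (∀ a b → N < a → h a b ≡ 0ℤ) → (∀ a b → N < b → h a b ≡ 0ℤ) →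
    ∑ N (λ a → ∑ N (h a)) ≡
    ∑ N (λ k → h k k) + (∑ N (λ c → ∑ N (λ k → h (c ℕ.+ k) k)) + ∑ N (λ c → ∑ N (λ k → h k (c ℕ.+ k))))
  ∑-trichotomy N h vanishˡ vanishʳ = trans (∑-square N h)
    (cong (λ z → ∑ N (λ k → h k k) + z) (cong₂ _+_ (∑-triangle N h vanishˡ) (∑-triangle N (flip h) λ b a → vanishʳ a b)))

  -- Kronecker delta

  -- As a factor of the summand it restricts a sum over a box to the solutions of an equation, so
  -- that sums can be exchanged freely.
  δ : ℕ → ℕ → ℤ
  δ m n with m ≟ n
  ... | yes _ = 1ℤ
  ... | no  _ = 0ℤ

  δ-refl : ∀ n → δ n n ≡ 1ℤ
  δ-refl n with n ≟ n
  ... | yes _   = refl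
  ... | no  n≢n = contradiction refl n≢n

  δ-≢ : ∀ {m n} → m ≢ n → δ m n ≡ 0ℤ
  δ-≢ {m} {n} m≢n with m ≟ n
  ... | yes m≡n = contradiction m≡n m≢n
  ... | no  _   = refl

  δ-> : ∀ {m n} → n < m → δ m n ≡ 0ℤ
  δ-> n<m = δ-≢ (ℕ.>⇒≢ n<m)

  δ-⇔ : ∀ {m n m′ n′} → (m ≡ n → m′ ≡ n′) → (m′ ≡ n′ → m ≡ n) → δ m n ≡ δ m′ n′
  δ-⇔ {m} {n} {m′} {n′} to from with m ≟ n | m′ ≟ n′
  ... | yes _ | yes _ = refl
  ... | no  _ | no  _ = refl
  ... | yes p | no ¬q = contradiction (to p) ¬q
  ... | no ¬p | yes q = contradiction (from q) ¬p

  -- At most one index, `i = suc u`, survives. The range from 1 to `m` is exactly that in which both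
  -- `i` and `suc m ∸ i` are positive.
  ∑-δ-convolution : ∀ m u v → ∑ m (λ i → δ (suc u) i * δ (suc v) (suc m ℕ.∸ i)) ≡ δ (suc u ℕ.+ suc v) (suc m)
  ∑-δ-convolution m u v with u ℕ.<? m
  ... | yes u<m = begin
    ∑ m (λ i → δ (suc u) i * δ (suc v) (suc m ℕ.∸ i))
      ≡⟨ ∑-single m u u<m (λ k k≢u → trans (cong (_* δ (suc v) (m ℕ.∸ k)) (δ-≢ λ e → k≢u (sym (ℕ.suc-injective e))))
           (*-zeroˡ (δ (suc v) (m ℕ.∸ k)))) ⟩
    δ (suc u) (suc u) * δ (suc v) (m ℕ.∸ u)
      ≡⟨ trans (cong (_* δ (suc v) (m ℕ.∸ u)) (δ-refl (suc u))) (*-identityˡ (δ (suc v) (m ℕ.∸ u))) ⟩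
    δ (suc v) (m ℕ.∸ u)
      ≡⟨ δ-⇔ (λ e → cong suc (trans (cong (u ℕ.+_) e) (ℕ.m+[n∸m]≡n (ℕ.<⇒≤ u<m))))
             (λ e → trans (sym (ℕ.m+n∸m≡n u (suc v))) (cong (ℕ._∸ u) (ℕ.suc-injective e))) ⟩
    δ (suc u ℕ.+ suc v) (suc m) ∎
  -- Here `suc u` lies beyond the range of `i`, and `suc u + suc v` is larger than `suc m`, so both
  -- sides are zero.
  ... | no  u≮m = trans
    (trans (∑-cong-≤ m {g = λ _ → 0ℤ} λ k k<m → trans (cong (_* δ (suc v) (m ℕ.∸ k)) (δ-≢ λ e → u≮m (subst (_< m) (sym (ℕ.suc-injective e)) k<m)))
             (*-zeroˡ (δ (suc v) (m ℕ.∸ k))))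
           (∑-zero m λ _ → refl))
    (sym (δ-> (s≤s (ℕ.≤-trans (s≤s (ℕ.≮⇒≥ u≮m)) (ℕ.m<m+n u (s≤s z≤n))))))

  -- Weighted counts of the solutions of a x + b y = n

  -- In a positive solution of either equation all variables are at most n, so these sums miss none.
  L D : ℕ → (ℕ → ℕ → ℕ → ℕ → ℤ) → ℤ
  L n h = ∑ n λ a → ∑ n λ b → ∑ n λ x → ∑ n λ y → δ (a ℕ.* x ℕ.+ b ℕ.* y) n * h a b x y
  D n h = ∑ n λ a → ∑ n λ b → ∑ n λ x → ∑ n λ y → δ ((a ℕ.+ b) ℕ.* x ℕ.+ b ℕ.* y) n * h a b x y

  Symmetric : (ℕ → ℕ → ℕ → ℕ → ℤ) → Set
  Symmetric h = ∀ a b x y → h a b x y ≡ h b a y x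

  swapped : (ℕ → ℕ → ℕ → ℕ → ℤ) → ℕ → ℕ → ℕ → ℕ → ℤ
  swapped h a b x y = h b a y x

  ∑⁴-cong : ∀ n {f g : ℕ → ℕ → ℕ → ℕ → ℤ} → (∀ a b x y → f (suc a) (suc b) (suc x) (suc y) ≡ g (suc a) (suc b) (suc x) (suc y)) →
    (∑ n λ a → ∑ n λ b → ∑ n λ x → ∑ n λ y → f a b x y) ≡ (∑ n λ a → ∑ n λ b → ∑ n λ x → ∑ n λ y → g a b x y)
  ∑⁴-cong n eq = ∑-cong n λ a → ∑-cong n λ b → ∑-cong n λ x → ∑-cong n λ y → eq a b x y

  L-cong : ∀ n {h k : ℕ → ℕ → ℕ → ℕ → ℤ} → (∀ a b x y → h (suc a) (suc b) (suc x) (suc y) ≡ k (suc a) (suc b) (suc x) (suc y)) → L n h ≡ L n k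
  L-cong n eq = ∑⁴-cong n λ a b x y → cong (δ (suc a ℕ.* suc x ℕ.+ suc b ℕ.* suc y) n *_) (eq a b x y)

  L-distrib-+ : ∀ n (h k : ℕ → ℕ → ℕ → ℕ → ℤ) → L n (λ a b x y → h a b x y + k a b x y) ≡ L n h + L n k
  L-distrib-+ n h k =
    trans (∑-cong n λ a →
      trans (∑-cong n λ b →
        trans (∑-cong n λ x →
          trans (∑-cong n λ y → *-distribˡ-+ (δ (suc a ℕ.* suc x ℕ.+ suc b ℕ.* suc y) n) (h (suc a) (suc b) (suc x) (suc y)) (k (suc a) (suc b) (suc x) (suc y)))
            (∑-distrib-+ n _ _))
          (∑-distrib-+ n _ _))
        (∑-distrib-+ n _ _))
      (∑-distrib-+ n _ _)

  *-distribˡ-L : ∀ n c (h : ℕ → ℕ → ℕ → ℕ → ℤ) → c * L n h ≡ L n (λ a b x y → c * h a b x y)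
  *-distribˡ-L n c h =
    trans (*-distribˡ-∑ n c _) (∑-cong n λ a →
      trans (*-distribˡ-∑ n c _) (∑-cong n λ b →
        trans (*-distribˡ-∑ n c _) (∑-cong n λ x →
          trans (*-distribˡ-∑ n c _) (∑-cong n λ y → exchange c (δ (suc a ℕ.* suc x ℕ.+ suc b ℕ.* suc y) n) (h (suc a) (suc b) (suc x) (suc y))))))
    where
    exchange : ∀ u v w → u * (v * w) ≡ v * (u * w)
    exchange = solve-∀

  L-swapped : ∀ n h → L n (swapped h) ≡ L n h
  L-swapped n h = trans (∑-swap n n _) (∑-cong n λ b → ∑-cong n λ a → trans (∑-swap n n _) (∑-cong n λ y → ∑-cong n λ x →
    cong (λ m → δ m n * h (suc b) (suc a) (suc y) (suc x)) (ℕ.+-comm (suc a ℕ.* suc x) (suc b ℕ.* suc y))))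

  δ-*ˡ-> : ∀ {n a} x z → n < a → δ (a ℕ.* suc x ℕ.+ z) n ≡ 0ℤ
  δ-*ˡ-> {a = a} x z n<a = δ-> (ℕ.<-≤-trans n<a (ℕ.≤-trans (ℕ.m≤m*n a (suc x)) (ℕ.m≤m+n _ z)))

  δ-*ʳ-> : ∀ {n x} a z → n < x → δ (suc a ℕ.* x ℕ.+ z) n ≡ 0ℤ
  δ-*ʳ-> {x = x} a z n<x = δ-> (ℕ.<-≤-trans n<x (ℕ.≤-trans (ℕ.m≤n*m x (suc a)) (ℕ.m≤m+n _ z)))

  *-vanishˡ : ∀ {u} v → u ≡ 0ℤ → u * v ≡ 0ℤ
  *-vanishˡ v refl = *-zeroˡ v

  -- Trichotomy on `a` and `b`. Exchanging the pairs (a,x) and (b,y) identifies the parts `a > b`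
  -- and `a < b`, and writing `a + b` for the larger coefficient gives `D`. Coefficients above `n`
  -- contribute nothing since `x` and `y` are positive.
  L-split-ab : ∀ n g → Symmetric g →
    L n g ≡ (∑ n λ a → ∑ n λ x → ∑ n λ y → δ (a ℕ.* x ℕ.+ a ℕ.* y) n * g a a x y)
          + (D n (λ a b → g (a ℕ.+ b) b) + D n (λ a b → g (a ℕ.+ b) b))
  L-split-ab n g g-sym = trans
    (∑-trichotomy n H vanish (λ a b n<b → trans (H-sym a b) (vanish b a n<b)))
    (cong (λ z → ∑ n (λ k → H k k) + (D n (λ a b → g (a ℕ.+ b) b) + z))
      (∑-cong n λ c → ∑-cong n λ k → H-sym (suc k) (suc (c ℕ.+ suc k))))
    where
    H : ℕ → ℕ → ℤ
    H a b = ∑ n λ x → ∑ n λ y → δ (a ℕ.* x ℕ.+ b ℕ.* y) n * g a b x y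
    H-sym : ∀ a b → H a b ≡ H b a
    H-sym a b = trans (∑-swap n n _) (∑-cong n λ y → ∑-cong n λ x →
      cong₂ (λ m → δ m n *_) (ℕ.+-comm (a ℕ.* suc x) (b ℕ.* suc y)) (g-sym a b (suc x) (suc y)))
    vanish : ∀ a b → n < a → H a b ≡ 0ℤ
    vanish a b n<a = ∑-zero n λ x → ∑-zero n λ y → *-vanishˡ (g a b (suc x) (suc y)) (δ-*ˡ-> x (b ℕ.* suc y) n<a)

  -- Trichotomy on `x` and `y` for fixed `a`, `b`. The exchange of pairs also exchanges `a` and `b`,
  -- so the two off-diagonal parts agree only after summation over both. On `y > x`, writing `y + x`
  -- for `y` turns the equation into that of `D`, by `regroup`.
  L-split-xy : ∀ n f → Symmetric f →
    L n f ≡ (∑ n λ a → ∑ n λ b → ∑ n λ x → δ (a ℕ.* x ℕ.+ b ℕ.* x) n * f a b x x)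
          + (D n (λ a b x y → f a b x (y ℕ.+ x)) + D n (λ a b x y → f a b x (y ℕ.+ x)))
  L-split-xy n f f-sym = begin
    L n f
      ≡⟨ ∑-cong n (λ a → ∑-cong n λ b → ∑-trichotomy n (K (suc a) (suc b))
           (λ x y n<x → *-vanishˡ (f (suc a) (suc b) x y) (δ-*ʳ-> a (suc b ℕ.* y) n<x))
           (λ x y n<y → *-vanishˡ (f (suc a) (suc b) x y)
              (trans (cong (λ m → δ m n) (ℕ.+-comm (suc a ℕ.* x) (suc b ℕ.* y))) (δ-*ʳ-> b (suc a ℕ.* x) n<y)))) ⟩
    (∑ n λ a → ∑ n λ b → diagonal a b + (above a b + below a b))
      ≡⟨ ∑²-distrib-+ diagonal (λ a b → above a b + below a b) ⟩
    ∑² diagonal + (∑ n λ a → ∑ n λ b → above a b + below a b)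
      ≡⟨ cong (λ z → ∑² diagonal + z) (∑²-distrib-+ above below) ⟩
    ∑² diagonal + (∑² above + ∑² below)
      ≡⟨ cong (λ z → ∑² diagonal + z) (cong₂ _+_ (trans above≡below below≡D) below≡D) ⟩
    ∑² diagonal + (D n (λ a b x y → f a b x (y ℕ.+ x)) + D n (λ a b x y → f a b x (y ℕ.+ x))) ∎
    where
    K : ℕ → ℕ → ℕ → ℕ → ℤ
    K a b x y = δ (a ℕ.* x ℕ.+ b ℕ.* y) n * f a b x y
    diagonal above below : ℕ → ℕ → ℤ
    diagonal a b = ∑ n λ x → K a b x x
    above a b = ∑ n λ c → ∑ n λ k → K a b (c ℕ.+ k) k
    below a b = ∑ n λ c → ∑ n λ k → K a b k (c ℕ.+ k)
    ∑² : (ℕ → ℕ → ℤ) → ℤ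
    ∑² g = ∑ n λ a → ∑ n λ b → g a b
    ∑²-distrib-+ : ∀ g h → ∑² (λ a b → g a b + h a b) ≡ ∑² g + ∑² h
    ∑²-distrib-+ g h = trans (∑-cong n λ a → ∑-distrib-+ n (g (suc a)) (h (suc a))) (∑-distrib-+ n (λ a → ∑ n (g a)) (λ a → ∑ n (h a)))
    above≡below : ∑² above ≡ ∑² below
    above≡below = trans (∑-swap n n above) (∑⁴-cong n λ b a c k →
      cong₂ (λ m → δ m n *_) (ℕ.+-comm (suc a ℕ.* (suc c ℕ.+ suc k)) (suc b ℕ.* suc k)) (f-sym (suc a) (suc b) (suc c ℕ.+ suc k) (suc k)))
    regroup : ∀ a b x y → a ℕ.* x ℕ.+ b ℕ.* (y ℕ.+ x) ≡ (a ℕ.+ b) ℕ.* x ℕ.+ b ℕ.* y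
    regroup = solveℕ-∀
    below≡D : ∑² below ≡ D n (λ a b x y → f a b x (y ℕ.+ x))
    below≡D = ∑-cong n λ a → ∑-cong n λ b → trans (∑-swap n n _) (∑-cong n λ x → ∑-cong n λ y →
      cong (λ m → δ m n * f (suc a) (suc b) (suc x) (suc y ℕ.+ suc x)) (regroup (suc a) (suc b) (suc x) (suc y)))

  -- Signs and the polynomial weights

  ε : ℕ → ℤ
  ε n = -1^ n

  ε-+ : ∀ m n → ε (m ℕ.+ n) ≡ ε m * ε n
  ε-+ = ^-distribˡ-+-* -1ℤ

  ε² : ∀ n → ε n * ε n ≡ 1ℤ
  ε² zero    = refl
  ε² (suc n) = trans (cancel-signs (ε n)) (ε² n)
    where
    cancel-signs : ∀ e → (-1ℤ * e) * (-1ℤ * e) ≡ e * e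
    cancel-signs = solve-∀

  -- Signs are variables separate from the numbers: `G` replaces `b` by its negative in the
  -- polynomials but keeps its sign factor, and the ring solver can treat every sign as an
  -- indeterminate.
  Φ : (A B ea eb ex ey : ℤ) → ℤ
  Φ A B ea eb ex ey =
    ex * eb * (B * (+ 2 * A + B) * (B * (+ 2 * A + B))) + ey * ea * (A * (+ 2 * B + A) * (A * (+ 2 * B + A)))
      + ex * ey * ea * eb * ((A * A + - (B * B)) * (A * A + - (B * B)))

  F G Q : ℕ → ℕ → ℕ → ℕ → ℤ
  F a b x y = Φ (+ a) (+ b) (ε a) (ε b) (ε x) (ε y)
  G a b x y = Φ (+ a) (- + b) (ε a) (ε b) (ε x) (ε y)
  Q a b x y = ε x * ε b * (+ a * (+ b * + b * + b))

  F-symmetric : Symmetric F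
  F-symmetric a b x y = identity (+ a) (+ b) (ε a) (ε b) (ε x) (ε y)
    where
    identity : ∀ A B ea eb ex ey →
      ex * eb * (B * (+ 2 * A + B) * (B * (+ 2 * A + B))) + ey * ea * (A * (+ 2 * B + A) * (A * (+ 2 * B + A)))
        + ex * ey * ea * eb * ((A * A + - (B * B)) * (A * A + - (B * B)))
      ≡ ey * ea * (A * (+ 2 * B + A) * (A * (+ 2 * B + A))) + ex * eb * (B * (+ 2 * A + B) * (B * (+ 2 * A + B)))
        + ey * ex * eb * ea * ((B * B + - (A * A)) * (B * B + - (A * A)))
    identity = solve-∀

  G-symmetric : Symmetric G
  G-symmetric a b x y = identity (+ a) (+ b) (ε a) (ε b) (ε x) (ε y)
    where
    identity : ∀ A B ea eb ex ey →
      ex * eb * ((- B) * (+ 2 * A + - B) * ((- B) * (+ 2 * A + - B))) + ey * ea * (A * (+ 2 * (- B) + A) * (A * (+ 2 * (- B) + A)))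
        + ex * ey * ea * eb * ((A * A + - ((- B) * (- B))) * (A * A + - ((- B) * (- B))))
      ≡ ey * ea * ((- A) * (+ 2 * B + - A) * ((- A) * (+ 2 * B + - A))) + ex * eb * (B * (+ 2 * (- A) + B) * (B * (+ 2 * (- A) + B)))
        + ey * ex * eb * ea * ((B * B + - ((- A) * (- A))) * (B * B + - ((- A) * (- A))))
    identity = solve-∀

  -- The first summands correspond, while the second and third change places:
  -- `(a+b)² - b² = a(a+2b)` and `(a+b)(a-b) = a² - b²`. The signs match because `ε x` and `ε b`
  -- square to 1.
  F-shear : ∀ a b x y → F a b x (y ℕ.+ x) ≡ G (a ℕ.+ b) b x y
  F-shear a b x y = begin
    F a b x (y ℕ.+ x)
      ≡⟨ cong (Φ (+ a) (+ b) (ε a) (ε b) (ε x)) (ε-+ y x) ⟩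
    Φ (+ a) (+ b) (ε a) (ε b) (ε x) (ε y * ε x)
      ≡⟨ left-normal (+ a) (+ b) (ε a) (ε b) (ε x) (ε y) ⟩
    middle (+ a) (+ b) (ε a) (ε b) (ε x) (ε y) (ε x * ε x) 1ℤ
      -- The two sides are equal as polynomials only up to the factors `ε x * ε x` and `ε b * ε b`;
      -- `middle` has one slot for each, where they are traded for 1.
      ≡⟨ cong₂ (middle (+ a) (+ b) (ε a) (ε b) (ε x) (ε y)) (ε² x) (sym (ε² b)) ⟩
    middle (+ a) (+ b) (ε a) (ε b) (ε x) (ε y) 1ℤ (ε b * ε b)
      ≡⟨ right-normal (+ a) (+ b) (ε a) (ε b) (ε x) (ε y) ⟩
    Φ (+ a + + b) (- + b) (ε a * ε b) (ε b) (ε x) (ε y)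
      ≡⟨ cong₂ (λ A ea → Φ A (- + b) ea (ε b) (ε x) (ε y)) (sym (pos-+ a b)) (sym (ε-+ a b)) ⟩
    G (a ℕ.+ b) b x y ∎
    where
    middle : (A B ea eb ex ey s t : ℤ) → ℤ
    middle A B ea eb ex ey s t =
      ex * eb * (B * (+ 2 * A + B) * (B * (+ 2 * A + B))) + t * (ey * ex * ea * (A * (+ 2 * B + A) * (A * (+ 2 * B + A))))
        + s * (ey * ea * eb * ((A * A + - (B * B)) * (A * A + - (B * B))))
    left-normal : ∀ A B ea eb ex ey →
      ex * eb * (B * (+ 2 * A + B) * (B * (+ 2 * A + B))) + (ey * ex) * ea * (A * (+ 2 * B + A) * (A * (+ 2 * B + A)))
        + ex * (ey * ex) * ea * eb * ((A * A + - (B * B)) * (A * A + - (B * B)))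
      ≡ ex * eb * (B * (+ 2 * A + B) * (B * (+ 2 * A + B))) + 1ℤ * (ey * ex * ea * (A * (+ 2 * B + A) * (A * (+ 2 * B + A))))
        + (ex * ex) * (ey * ea * eb * ((A * A + - (B * B)) * (A * A + - (B * B))))
    left-normal = solve-∀
    right-normal : ∀ A B ea eb ex ey →
      ex * eb * (B * (+ 2 * A + B) * (B * (+ 2 * A + B))) + (eb * eb) * (ey * ex * ea * (A * (+ 2 * B + A) * (A * (+ 2 * B + A))))
        + 1ℤ * (ey * ea * eb * ((A * A + - (B * B)) * (A * A + - (B * B))))
      ≡ ex * eb * ((- B) * (+ 2 * (A + B) + - B) * ((- B) * (+ 2 * (A + B) + - B)))
        + ey * (ea * eb) * ((A + B) * (+ 2 * (- B) + (A + B)) * ((A + B) * (+ 2 * (- B) + (A + B))))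
        + ex * ey * (ea * eb) * eb * (((A + B) * (A + B) + - ((- B) * (- B))) * ((A + B) * (A + B) + - ((- B) * (- B))))
    right-normal = solve-∀

  -- Only the terms odd in `b` survive in the difference: `b²(2a+b)² - b²(2a-b)² = 8ab³`, likewise
  -- `8a³b` from the second summand, and nothing from the third.
  F-decompose : ∀ a b x y → F a b x y ≡ G a b x y + + 8 * (Q a b x y + Q b a y x)
  F-decompose a b x y = identity (+ a) (+ b) (ε a) (ε b) (ε x) (ε y)
    where
    identity : ∀ A B ea eb ex ey →
      ex * eb * (B * (+ 2 * A + B) * (B * (+ 2 * A + B))) + ey * ea * (A * (+ 2 * B + A) * (A * (+ 2 * B + A)))
        + ex * ey * ea * eb * ((A * A + - (B * B)) * (A * A + - (B * B)))
      ≡ ex * eb * ((- B) * (+ 2 * A + - B) * ((- B) * (+ 2 * A + - B))) + ey * ea * (A * (+ 2 * (- B) + A) * (A * (+ 2 * (- B) + A)))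
        + ex * ey * ea * eb * ((A * A + - ((- B) * (- B))) * (A * A + - ((- B) * (- B))))
        + + 8 * (ex * eb * (A * (B * B * B)) + ey * ea * (B * (A * A * A)))
    identity = solve-∀

  diag-G diag-F : ℕ → ℤ
  diag-G n = ∑ n λ a → ∑ n λ x → ∑ n λ y → δ (a ℕ.* x ℕ.+ a ℕ.* y) n * G a a x y
  diag-F n = ∑ n λ a → ∑ n λ b → ∑ n λ x → δ (a ℕ.* x ℕ.+ b ℕ.* x) n * F a b x x

  -- By `F-shear` both splittings contain the same `D`, which cancels. The factor 16 is 8 doubled,
  -- as `Q` and its swapped form have equal sums.
  LQ-diagonals : ∀ n → + 16 * L n Q + diag-G n ≡ diag-F n
  LQ-diagonals n = solve-linear (L n F) (L n G) (L n Q) (diag-G n) (diag-F n) (D n (λ a b → G (a ℕ.+ b) b))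
    F≡G+Q
    (L-split-ab n G G-symmetric)
    (trans (L-split-xy n F F-symmetric) (cong (λ d → diag-F n + (d + d)) F-shear-D))
    where
    F-shear-D : D n (λ a b x y → F a b x (y ℕ.+ x)) ≡ D n (λ a b → G (a ℕ.+ b) b)
    F-shear-D = ∑⁴-cong n λ a b x y → cong (δ ((suc a ℕ.+ suc b) ℕ.* suc x ℕ.+ suc b ℕ.* suc y) n *_) (F-shear (suc a) (suc b) (suc x) (suc y))
    F≡G+Q : L n F ≡ L n G + + 8 * (L n Q + L n Q)
    F≡G+Q = begin
      L n F
        ≡⟨ L-cong n (λ a b x y → F-decompose (suc a) (suc b) (suc x) (suc y)) ⟩
      L n (λ a b x y → G a b x y + + 8 * (Q a b x y + swapped Q a b x y))
        ≡⟨ L-distrib-+ n G _ ⟩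
      L n G + L n (λ a b x y → + 8 * (Q a b x y + swapped Q a b x y))
        ≡⟨ cong (λ z → L n G + z) (sym (*-distribˡ-L n (+ 8) _)) ⟩
      L n G + + 8 * L n (λ a b x y → Q a b x y + swapped Q a b x y)
        ≡⟨ cong (λ z → L n G + + 8 * z) (trans (L-distrib-+ n Q (swapped Q)) (cong (λ z → L n Q + z) (L-swapped n Q))) ⟩
      L n G + + 8 * (L n Q + L n Q) ∎
    solve-linear : ∀ f g q dg df d → f ≡ g + + 8 * (q + q) → g ≡ dg + (d + d) → f ≡ df + (d + d) → + 16 * q + dg ≡ df
    solve-linear f g q dg df d f≡ g≡ f≡′ = begin
      + 16 * q + dg                                  ≡⟨ expand q dg d ⟩
      dg + (d + d) + + 8 * (q + q) + - (d + d)       ≡⟨ cong (λ z → z + + 8 * (q + q) + - (d + d)) (sym g≡) ⟩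
      g + + 8 * (q + q) + - (d + d)                  ≡⟨ cong (_+ - (d + d)) (trans (sym f≡) f≡′) ⟩
      df + (d + d) + - (d + d)                       ≡⟨ cancel df d ⟩
      df                                             ∎
      where
      expand : ∀ q dg d → + 16 * q + dg ≡ dg + (d + d) + + 8 * (q + q) + - (d + d)
      expand = solve-∀
      cancel : ∀ df d → df + (d + d) + - (d + d) ≡ df
      cancel = solve-∀

  -- Diagonal sums as divisor sums

  -- A divisor sum taken over the ordered factorisations `d * e = n`, so that the summand may refer
  -- to the divisor and the codivisor alike.
  𝒟 : ℕ → (ℕ → ℕ → ℤ) → ℤ
  𝒟 n φ = ∑ n λ d → ∑ n λ e → δ (d ℕ.* e) n * φ d e

  𝒟-cong : ∀ n {φ ψ : ℕ → ℕ → ℤ} → (∀ d e → φ (suc d) (suc e) ≡ ψ (suc d) (suc e)) → 𝒟 n φ ≡ 𝒟 n ψ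
  𝒟-cong n eq = ∑-cong n λ d → ∑-cong n λ e → cong (δ (suc d ℕ.* suc e) n *_) (eq d e)

  𝒟-distrib-+ : ∀ n (φ ψ : ℕ → ℕ → ℤ) → 𝒟 n (λ d e → φ d e + ψ d e) ≡ 𝒟 n φ + 𝒟 n ψ
  𝒟-distrib-+ n φ ψ =
    trans (∑-cong n λ d →
      trans (∑-cong n λ e → *-distribˡ-+ (δ (suc d ℕ.* suc e) n) (φ (suc d) (suc e)) (ψ (suc d) (suc e)))
        (∑-distrib-+ n _ _))
      (∑-distrib-+ n _ _)

  *-distribˡ-𝒟 : ∀ n c (φ : ℕ → ℕ → ℤ) → c * 𝒟 n φ ≡ 𝒟 n (λ d e → c * φ d e)
  *-distribˡ-𝒟 n c φ =
    trans (*-distribˡ-∑ n c _) (∑-cong n λ d →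
      trans (*-distribˡ-∑ n c _) (∑-cong n λ e → exchange c (δ (suc d ℕ.* suc e) n) (φ (suc d) (suc e))))
    where
    exchange : ∀ u v w → u * (v * w) ≡ v * (u * w)
    exchange = solve-∀

  sum-ε : ∀ k → + 2 * ∑ k ε ≡ ε k + -1ℤ
  sum-ε zero    = refl
  sum-ε (suc k) = begin
    + 2 * (∑ k ε + -1ℤ * ε k)      ≡⟨ *-distribˡ-+ (+ 2) (∑ k ε) (-1ℤ * ε k) ⟩
    + 2 * ∑ k ε + + 2 * (-1ℤ * ε k) ≡⟨ cong (_+ + 2 * (-1ℤ * ε k)) (sum-ε k) ⟩
    ε k + -1ℤ + + 2 * (-1ℤ * ε k)   ≡⟨ step (ε k) ⟩
    -1ℤ * ε k + -1ℤ                 ∎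
    where
    step : ∀ e → e + -1ℤ + + 2 * (-1ℤ * e) ≡ -1ℤ * e + -1ℤ
    step = solve-∀

  diag-G-summand : ℕ → ℕ → ℕ → ℤ
  diag-G-summand a m y = (ε m + 1ℤ) * (ε a * (+ a * + a * + a * + a)) * ε y

  -- For `a = b` the third summand of `G` vanishes and the others leave `(ε x + ε y) * w`; then
  -- `ε x` is `ε (x + y) * ε y`. The equation reads `a (x + y) = n`, hence the passage to `x + y`.
  G-diagonal : ∀ a x y → G a a x y ≡ diag-G-summand a (x ℕ.+ y) y
  G-diagonal a x y = begin
    G a a x y
      ≡⟨ left-normal (+ a) (ε a) (ε x) (ε y) ⟩
    (ε x * 1ℤ + ε y) * w
      ≡⟨ cong (λ s → (ε x * s + ε y) * w) (sym (ε² y)) ⟩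
    (ε x * (ε y * ε y) + ε y) * w
      ≡⟨ right-normal w (ε x) (ε y) ⟩
    (ε x * ε y + 1ℤ) * w * ε y
      ≡⟨ cong (λ e → (e + 1ℤ) * w * ε y) (sym (ε-+ x y)) ⟩
    diag-G-summand a (x ℕ.+ y) y ∎
    where
    w : ℤ
    w = ε a * (+ a * + a * + a * + a)
    left-normal : ∀ A ea ex ey →
      ex * ea * ((- A) * (+ 2 * A + - A) * ((- A) * (+ 2 * A + - A))) + ey * ea * (A * (+ 2 * (- A) + A) * (A * (+ 2 * (- A) + A)))
        + ex * ey * ea * ea * ((A * A + - ((- A) * (- A))) * (A * A + - ((- A) * (- A))))
      ≡ (ex * 1ℤ + ey) * (ea * (A * A * A * A))
    left-normal = solve-∀
    right-normal : ∀ w ex ey → (ex * (ey * ey) + ey) * w ≡ (ex * ey + 1ℤ) * w * ey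
    right-normal = solve-∀

  -- The factor `ε (suc k) + 1ℤ` vanishes for odd `suc k`; for even `suc k` the alternating sum up
  -- to `k` is -1. The multiple 6 is the one that clears denominators in `sum-diag-F`.
  sum-diag-G : ∀ a k → + 6 * ∑ k (diag-G-summand a (suc k)) ≡ - (+ 6) * ((1ℤ + ε (suc k)) * (ε a * (+ a * + a * + a * + a)))
  sum-diag-G a k = begin
    + 6 * ∑ k (λ y → c * ε y)      ≡⟨ cong (+ 6 *_) (sym (*-distribˡ-∑ k c ε)) ⟩
    + 6 * (c * ∑ k ε)              ≡⟨ regroup c (∑ k ε) ⟩
    + 3 * c * (+ 2 * ∑ k ε)        ≡⟨ cong (+ 3 * c *_) (sum-ε k) ⟩
    + 3 * c * (ε k + -1ℤ)          ≡⟨ expand (ε k) w ⟩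
    - (+ 3) * ((1ℤ + + 2 * ε (suc k) + ε k * ε k) * w)
      ≡⟨ cong (λ s → - (+ 3) * ((1ℤ + + 2 * ε (suc k) + s) * w)) (ε² k) ⟩
    - (+ 3) * ((1ℤ + + 2 * ε (suc k) + 1ℤ) * w)
      ≡⟨ collect (ε (suc k)) w ⟩
    - (+ 6) * ((1ℤ + ε (suc k)) * w) ∎
    where
    w c : ℤ
    w = ε a * (+ a * + a * + a * + a)
    c = (ε (suc k) + 1ℤ) * w
    regroup : ∀ c s → + 6 * (c * s) ≡ + 3 * c * (+ 2 * s)
    regroup = solve-∀
    expand : ∀ e w → + 3 * ((-1ℤ * e + 1ℤ) * w) * (e + -1ℤ) ≡ - (+ 3) * ((1ℤ + + 2 * (-1ℤ * e) + e * e) * w)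
    expand = solve-∀
    collect : ∀ e w → - (+ 3) * ((1ℤ + + 2 * e + 1ℤ) * w) ≡ - (+ 6) * ((1ℤ + e) * w)
    collect = solve-∀

  diag-G-divisors : ∀ n → diag-G n ≡ 𝒟 n (λ d e → ∑ (pred e) (diag-G-summand d e))
  diag-G-divisors n = ∑-cong n λ a → begin
    (∑ n λ x → ∑ n λ y → δ (suc a ℕ.* x ℕ.+ suc a ℕ.* y) n * G (suc a) (suc a) x y)
      ≡⟨ ∑-cong n (λ x → ∑-cong n λ y → cong₂ (λ m z → δ m n * z)
           (sym (ℕ.*-distribˡ-+ (suc a) (suc x) (suc y))) (G-diagonal (suc a) (suc x) (suc y))) ⟩
    (∑ n λ x → ∑ n λ y → δ (suc a ℕ.* (x ℕ.+ y)) n * diag-G-summand (suc a) (x ℕ.+ y) y)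
      ≡⟨ ∑-triangle n (λ m y → δ (suc a ℕ.* m) n * diag-G-summand (suc a) m y)
           (λ m y n<m → *-vanishˡ (diag-G-summand (suc a) m y) (δ-> (ℕ.<-≤-trans n<m (ℕ.m≤n*m m (suc a))))) ⟨
    (∑ n λ m → ∑ (pred m) λ y → δ (suc a ℕ.* m) n * diag-G-summand (suc a) m y)
      ≡⟨ ∑-cong n (λ m → sym (*-distribˡ-∑ m (δ (suc a ℕ.* suc m) n) (diag-G-summand (suc a) (suc m)))) ⟩
    (∑ n λ m → δ (suc a ℕ.* m) n * ∑ (pred m) (diag-G-summand (suc a) m)) ∎

  diag-F-summand : ℕ → ℕ → ℕ → ℤ
  diag-F-summand x m b = summand (+ m) (+ b) (ε m) (ε b) (ε x)
    where
    summand : (M B em eb ex : ℤ) → ℤ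
    summand M B em eb ex =
      ex * eb * (B * (+ 2 * M + - B) * (B * (+ 2 * M + - B)))
        + ex * (em * eb) * ((M * M + - (B * B)) * (M * M + - (B * B)))
        + em * (M * (M + - (+ 2 * B)) * (M * (M + - (+ 2 * B))))

  -- For `x = y` the equation reads `(a + b) x = n`, so `a` is eliminated in favour of `m = a + b`:
  -- `2a + b = 2m - b`, `a(a+2b) = m² - b²` and `a² - b² = m(m-2b)`.
  F-diagonal : ∀ a b x → F a b x x ≡ diag-F-summand x (a ℕ.+ b) b
  F-diagonal a b x = begin
    F a b x x
      ≡⟨ left-normal (+ a) (+ b) (ε a) (ε b) (ε x) ⟩
    middle (ε x * ε x) 1ℤ
      ≡⟨ cong₂ middle (ε² x) (sym (ε² b)) ⟩
    middle 1ℤ (ε b * ε b)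
      ≡⟨ right-normal (+ a) (+ b) (ε a) (ε b) (ε x) ⟩
    right (+ a + + b) (ε a * ε b)
      ≡⟨ cong₂ right (sym (pos-+ a b)) (sym (ε-+ a b)) ⟩
    diag-F-summand x (a ℕ.+ b) b ∎
    where
    middle right : ℤ → ℤ → ℤ
    middle s t =
      ε x * ε b * (+ b * (+ 2 * + a + + b) * (+ b * (+ 2 * + a + + b)))
        + t * (ε x * ε a * (+ a * (+ 2 * + b + + a) * (+ a * (+ 2 * + b + + a))))
        + s * (ε a * ε b * ((+ a * + a + - (+ b * + b)) * (+ a * + a + - (+ b * + b))))
    right M em =
      ε x * ε b * (+ b * (+ 2 * M + - + b) * (+ b * (+ 2 * M + - + b)))
        + ε x * (em * ε b) * ((M * M + - (+ b * + b)) * (M * M + - (+ b * + b)))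
        + em * (M * (M + - (+ 2 * + b)) * (M * (M + - (+ 2 * + b))))
    left-normal : ∀ A B ea eb ex →
      ex * eb * (B * (+ 2 * A + B) * (B * (+ 2 * A + B))) + ex * ea * (A * (+ 2 * B + A) * (A * (+ 2 * B + A)))
        + ex * ex * ea * eb * ((A * A + - (B * B)) * (A * A + - (B * B)))
      ≡ ex * eb * (B * (+ 2 * A + B) * (B * (+ 2 * A + B))) + 1ℤ * (ex * ea * (A * (+ 2 * B + A) * (A * (+ 2 * B + A))))
        + (ex * ex) * (ea * eb * ((A * A + - (B * B)) * (A * A + - (B * B))))
    left-normal = solve-∀
    right-normal : ∀ A B ea eb ex →
      ex * eb * (B * (+ 2 * A + B) * (B * (+ 2 * A + B))) + (eb * eb) * (ex * ea * (A * (+ 2 * B + A) * (A * (+ 2 * B + A))))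
        + 1ℤ * (ea * eb * ((A * A + - (B * B)) * (A * A + - (B * B))))
      ≡ ex * eb * (B * (+ 2 * (A + B) + - B) * (B * (+ 2 * (A + B) + - B)))
        + ex * ((ea * eb) * eb) * (((A + B) * (A + B) + - (B * B)) * ((A + B) * (A + B) + - (B * B)))
        + (ea * eb) * ((A + B) * ((A + B) + - (+ 2 * B)) * ((A + B) * ((A + B) + - (+ 2 * B))))
    right-normal = solve-∀

  -- Obtained from 2 Σ (-1)^b b² = (-1)^k (k²+k), 8 Σ (-1)^b b³ = (-1)^k (4k³+6k²-1) + 1 and
  -- 2 Σ (-1)^b b⁴ = (-1)^k (k⁴+2k³-k), the sums running over 1 ≤ b ≤ k.
  partial-sum-diag-F : ∀ x m k → + 6 * ∑ k (diag-F-summand x m) ≡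
      + 3 * ε x * (ε k * (+ 4 * + m * + m * (+ k * + k + + k) + - (+ 4 * + m * + k * + k * + k) + - (+ 6 * + m * + k * + k) + + m
                          + + k * + k * + k * + k + + 2 * + k * + k * + k + - + k) + - + m)
      + + 3 * ε x * ε m * (ε k * (+ m * + m * + m * + m + - (+ 2 * + m * + m * (+ k * + k + + k))
                          + + k * + k * + k * + k + + 2 * + k * + k * + k + - + k) + - (+ m * + m * + m * + m))
      + + 2 * ε m * + m * + m * (+ 3 * + k * + m * + m + - (+ 6 * + m * + k * (+ k + 1ℤ)) + + 2 * + k * (+ k + 1ℤ) * (+ 2 * + k + 1ℤ))
  partial-sum-diag-F x m zero    = base (+ m) (ε m) (ε x)
    where
    base : ∀ M em ex → + 0 ≡
      + 3 * ex * (1ℤ * (+ 4 * M * M * (+ 0 * + 0 + + 0) + - (+ 4 * M * + 0 * + 0 * + 0) + - (+ 6 * M * + 0 * + 0) + M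
                          + + 0 * + 0 * + 0 * + 0 + + 2 * + 0 * + 0 * + 0 + - + 0) + - M)
      + + 3 * ex * em * (1ℤ * (M * M * M * M + - (+ 2 * M * M * (+ 0 * + 0 + + 0))
                          + + 0 * + 0 * + 0 * + 0 + + 2 * + 0 * + 0 * + 0 + - + 0) + - (M * M * M * M))
      + + 2 * em * M * M * (+ 3 * + 0 * M * M + - (+ 6 * M * + 0 * (+ 0 + 1ℤ)) + + 2 * + 0 * (+ 0 + 1ℤ) * (+ 2 * + 0 + 1ℤ))
    base = solve-∀
  partial-sum-diag-F x m (suc k) = trans (*-distribˡ-+ (+ 6) (∑ k (diag-F-summand x m)) (diag-F-summand x m (suc k)))
    (trans (cong (_+ + 6 * diag-F-summand x m (suc k)) (partial-sum-diag-F x m k)) (step (+ m) (+ k) (ε m) (ε k) (ε x)))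
    where
    step : ∀ M K em ek ex →
      + 3 * ex * (ek * (+ 4 * M * M * (K * K + K) + - (+ 4 * M * K * K * K) + - (+ 6 * M * K * K) + M
                          + K * K * K * K + + 2 * K * K * K + - K) + - M)
      + + 3 * ex * em * (ek * (M * M * M * M + - (+ 2 * M * M * (K * K + K))
                          + K * K * K * K + + 2 * K * K * K + - K) + - (M * M * M * M))
      + + 2 * em * M * M * (+ 3 * K * M * M + - (+ 6 * M * K * (K + 1ℤ)) + + 2 * K * (K + 1ℤ) * (+ 2 * K + 1ℤ))
      + + 6 * (ex * (-1ℤ * ek) * ((1ℤ + K) * (+ 2 * M + - (1ℤ + K)) * ((1ℤ + K) * (+ 2 * M + - (1ℤ + K))))
        + ex * (em * (-1ℤ * ek)) * ((M * M + - ((1ℤ + K) * (1ℤ + K))) * (M * M + - ((1ℤ + K) * (1ℤ + K))))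
        + em * (M * (M + - (+ 2 * (1ℤ + K))) * (M * (M + - (+ 2 * (1ℤ + K))))))
      ≡
      + 3 * ex * ((-1ℤ * ek) * (+ 4 * M * M * ((1ℤ + K) * (1ℤ + K) + (1ℤ + K)) + - (+ 4 * M * (1ℤ + K) * (1ℤ + K) * (1ℤ + K)) + - (+ 6 * M * (1ℤ + K) * (1ℤ + K)) + M
                          + (1ℤ + K) * (1ℤ + K) * (1ℤ + K) * (1ℤ + K) + + 2 * (1ℤ + K) * (1ℤ + K) * (1ℤ + K) + - (1ℤ + K)) + - M)
      + + 3 * ex * em * ((-1ℤ * ek) * (M * M * M * M + - (+ 2 * M * M * ((1ℤ + K) * (1ℤ + K) + (1ℤ + K)))
                          + (1ℤ + K) * (1ℤ + K) * (1ℤ + K) * (1ℤ + K) + + 2 * (1ℤ + K) * (1ℤ + K) * (1ℤ + K) + - (1ℤ + K)) + - (M * M * M * M))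
      + + 2 * em * M * M * (+ 3 * (1ℤ + K) * M * M + - (+ 6 * M * (1ℤ + K) * ((1ℤ + K) + 1ℤ)) + + 2 * (1ℤ + K) * ((1ℤ + K) + 1ℤ) * (+ 2 * (1ℤ + K) + 1ℤ))
    step = solve-∀

  -- The closed form for partial sums is evaluated at the end of the range `b < m`, where
  -- `k = m - 1`; there `ε m * ε k` is -1 and most terms collapse.
  sum-diag-F : ∀ x k → let m = suc k; M = + m in
    + 6 * ∑ k (diag-F-summand x m) ≡
    + 6 * ε x * (- (ε m * (M * M * M * M)) + - M) + + 2 * ε m * (M * M * M * M * M + - (+ 3 * (M * M * M * M)) + + 2 * (M * M * M))
  sum-diag-F x k = trans (partial-sum-diag-F x (suc k) k)
    (trans (expand (+ k) (ε k) (ε x)) (trans (cong (factored (+ suc k) (ε k) (ε x)) (ε² k)) (collect (+ suc k) (ε k) (ε x))))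
    where
    factored : (M e ex s : ℤ) → ℤ
    factored M e ex s =
      + 3 * ex * (+ 2 * e * (M * M * M * M) + - M + - (s * M))
      + + 2 * (-1ℤ * e) * (M * M * M * M * M + - (+ 3 * (M * M * M * M)) + + 2 * (M * M * M))
    expand : ∀ K e ex →
      + 3 * ex * (e * (+ 4 * (1ℤ + K) * (1ℤ + K) * (K * K + K) + - (+ 4 * (1ℤ + K) * K * K * K) + - (+ 6 * (1ℤ + K) * K * K) + (1ℤ + K)
                          + K * K * K * K + + 2 * K * K * K + - K) + - (1ℤ + K))
      + + 3 * ex * (-1ℤ * e) * (e * ((1ℤ + K) * (1ℤ + K) * (1ℤ + K) * (1ℤ + K) + - (+ 2 * (1ℤ + K) * (1ℤ + K) * (K * K + K))
                          + K * K * K * K + + 2 * K * K * K + - K) + - ((1ℤ + K) * (1ℤ + K) * (1ℤ + K) * (1ℤ + K)))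
      + + 2 * (-1ℤ * e) * (1ℤ + K) * (1ℤ + K) * (+ 3 * K * (1ℤ + K) * (1ℤ + K) + - (+ 6 * (1ℤ + K) * K * (K + 1ℤ)) + + 2 * K * (K + 1ℤ) * (+ 2 * K + 1ℤ))
      ≡
      + 3 * ex * (+ 2 * e * ((1ℤ + K) * (1ℤ + K) * (1ℤ + K) * (1ℤ + K)) + - (1ℤ + K) + - (e * e * (1ℤ + K)))
      + + 2 * (-1ℤ * e) * ((1ℤ + K) * (1ℤ + K) * (1ℤ + K) * (1ℤ + K) * (1ℤ + K) + - (+ 3 * ((1ℤ + K) * (1ℤ + K) * (1ℤ + K) * (1ℤ + K))) + + 2 * ((1ℤ + K) * (1ℤ + K) * (1ℤ + K)))
    expand = solve-∀
    collect : ∀ M e ex →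
      + 3 * ex * (+ 2 * e * (M * M * M * M) + - M + - (1ℤ * M))
      + + 2 * (-1ℤ * e) * (M * M * M * M * M + - (+ 3 * (M * M * M * M)) + + 2 * (M * M * M))
      ≡ + 6 * ex * (- ((-1ℤ * e) * (M * M * M * M)) + - M) + + 2 * (-1ℤ * e) * (M * M * M * M * M + - (+ 3 * (M * M * M * M)) + + 2 * (M * M * M))
    collect = solve-∀

  -- The factorisation is `d = a + b`, `e = x`; for fixed `d` the remaining variable `b` runs from 1
  -- to `d - 1`.
  diag-F-divisors : ∀ n → diag-F n ≡ 𝒟 n (λ d e → ∑ (pred d) (diag-F-summand e d))
  diag-F-divisors n = begin
    diag-F n
      ≡⟨ ∑-cong n (λ a → ∑-swap n n _) ⟩
    (∑ n λ a → ∑ n λ x → ∑ n λ b → δ (a ℕ.* x ℕ.+ b ℕ.* x) n * F a b x x)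
      ≡⟨ ∑-swap n n _ ⟩
    (∑ n λ x → ∑ n λ a → ∑ n λ b → δ (a ℕ.* x ℕ.+ b ℕ.* x) n * F a b x x)
      ≡⟨ ∑-cong n (λ x → by-sum (suc x) (ℕ.m≤m*n _ (suc x))) ⟩
    (∑ n λ x → ∑ n λ m → δ (m ℕ.* x) n * ∑ (pred m) (diag-F-summand x m))
      ≡⟨ ∑-swap n n _ ⟩
    𝒟 n (λ d e → ∑ (pred d) (diag-F-summand e d)) ∎
    where
    -- The bound `m ≤ m * x`, valid for positive `x`, is what makes the terms with `m > n` vanish in
    -- `∑-triangle`.
    by-sum : ∀ x → (∀ {m} → m ≤ m ℕ.* x) →
      (∑ n λ a → ∑ n λ b → δ (a ℕ.* x ℕ.+ b ℕ.* x) n * F a b x x) ≡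
      (∑ n λ m → δ (m ℕ.* x) n * ∑ (pred m) (diag-F-summand x m))
    by-sum x m≤m*x = begin
      (∑ n λ a → ∑ n λ b → δ (a ℕ.* x ℕ.+ b ℕ.* x) n * F a b x x)
        ≡⟨ ∑-cong n (λ a → ∑-cong n λ b → cong₂ (λ m z → δ m n * z)
             (sym (ℕ.*-distribʳ-+ x (suc a) (suc b))) (F-diagonal (suc a) (suc b) x)) ⟩
      (∑ n λ a → ∑ n λ b → δ ((a ℕ.+ b) ℕ.* x) n * diag-F-summand x (a ℕ.+ b) b)
        ≡⟨ ∑-triangle n (λ m b → δ (m ℕ.* x) n * diag-F-summand x m b)
             (λ m b n<m → *-vanishˡ (diag-F-summand x m b) (δ-> (ℕ.<-≤-trans n<m m≤m*x))) ⟨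
      (∑ n λ m → ∑ (pred m) λ b → δ (m ℕ.* x) n * diag-F-summand x m b)
        ≡⟨ ∑-cong n (λ m → sym (*-distribˡ-∑ m (δ (suc m ℕ.* x) n) (diag-F-summand x (suc m)))) ⟩
      (∑ n λ m → δ (m ℕ.* x) n * ∑ (pred m) (diag-F-summand x m)) ∎

  -- Comparison of the two diagonals

  tilde-term : ℕ → ℕ → ℕ → ℤ
  tilde-term s d e = (-1^ (d ℕ.∸ 1)) * (+ d) ℤ.^ s

  hat-term : ℕ → ℕ → ℤ
  hat-term d e = (-1^ (e ℕ.∸ 1)) * + d

  -- The fourth powers of the divisor cancel between the two closed forms. What is left has degrees
  -- 5, 3 and 1, which are the summands of `σ-tilde 5`, `σ-tilde 3` and `σ-hat`.
  diagonals-termwise : ∀ d e →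
    + 6 * ∑ d (diag-F-summand (suc e) (suc d)) + (+ 2 * tilde-term 5 (suc d) (suc e) + + 4 * tilde-term 3 (suc d) (suc e))
    ≡ + 6 * ∑ e (diag-G-summand (suc d) (suc e)) + + 6 * hat-term (suc d) (suc e)
  diagonals-termwise d e = begin
    + 6 * ∑ d (diag-F-summand (suc e) (suc d)) + (+ 2 * tilde-term 5 (suc d) (suc e) + + 4 * tilde-term 3 (suc d) (suc e))
      ≡⟨ cong (_+ (+ 2 * tilde-term 5 (suc d) (suc e) + + 4 * tilde-term 3 (suc d) (suc e))) (sum-diag-F (suc e) d) ⟩
    _ ≡⟨ identity (+ suc d) (ε d) (ε e) ⟩
    _ ≡⟨ cong (_+ + 6 * hat-term (suc d) (suc e)) (sym (sum-diag-G (suc d) e)) ⟩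
    + 6 * ∑ e (diag-G-summand (suc d) (suc e)) + + 6 * hat-term (suc d) (suc e) ∎
    where
    identity : ∀ M u v →
      + 6 * (-1ℤ * v) * (- ((-1ℤ * u) * (M * M * M * M)) + - M) + + 2 * (-1ℤ * u) * (M * M * M * M * M + - (+ 3 * (M * M * M * M)) + + 2 * (M * M * M))
        + (+ 2 * (u * (M * (M * (M * (M * (M * 1ℤ)))))) + + 4 * (u * (M * (M * (M * 1ℤ)))))
      ≡ - (+ 6) * ((1ℤ + (-1ℤ * v)) * ((-1ℤ * u) * (M * M * M * M))) + + 6 * (v * M)
    identity = solve-∀

  LQ-divisors : ∀ n → + 48 * L n Q + (𝒟 n (tilde-term 5) + + 2 * 𝒟 n (tilde-term 3)) ≡ + 3 * 𝒟 n hat-term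
  LQ-divisors n = solve-linear (L n Q) (diag-F n) (diag-G n) (𝒟 n (tilde-term 5)) (𝒟 n (tilde-term 3)) (𝒟 n hat-term)
    (LQ-diagonals n) diagonals
    where
    φF φG : ℕ → ℕ → ℤ
    φF d e = ∑ (pred d) (diag-F-summand e d)
    φG d e = ∑ (pred e) (diag-G-summand d e)
    combine : ∀ c (φ : ℕ → ℕ → ℤ) c′ (ψ : ℕ → ℕ → ℤ) → 𝒟 n (λ d e → c * φ d e + c′ * ψ d e) ≡ c * 𝒟 n φ + c′ * 𝒟 n ψ
    combine c φ c′ ψ = trans (𝒟-distrib-+ n (λ d e → c * φ d e) (λ d e → c′ * ψ d e))
      (cong₂ _+_ (sym (*-distribˡ-𝒟 n c φ)) (sym (*-distribˡ-𝒟 n c′ ψ)))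
    diagonals : + 6 * diag-F n + (+ 2 * 𝒟 n (tilde-term 5) + + 4 * 𝒟 n (tilde-term 3)) ≡ + 6 * diag-G n + + 6 * 𝒟 n hat-term
    diagonals = begin
      + 6 * diag-F n + (+ 2 * 𝒟 n (tilde-term 5) + + 4 * 𝒟 n (tilde-term 3))
        ≡⟨ cong₂ _+_ (trans (cong (+ 6 *_) (diag-F-divisors n)) (*-distribˡ-𝒟 n (+ 6) φF))
             (sym (combine (+ 2) (tilde-term 5) (+ 4) (tilde-term 3))) ⟩
      _ ≡⟨ sym (𝒟-distrib-+ n (λ d e → + 6 * φF d e) (λ d e → + 2 * tilde-term 5 d e + + 4 * tilde-term 3 d e)) ⟩
      _ ≡⟨ 𝒟-cong n diagonals-termwise ⟩
      𝒟 n (λ d e → + 6 * φG d e + + 6 * hat-term d e)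
        ≡⟨ combine (+ 6) φG (+ 6) hat-term ⟩
      + 6 * 𝒟 n φG + + 6 * 𝒟 n hat-term
        ≡⟨ cong (λ z → + 6 * z + + 6 * 𝒟 n hat-term) (sym (diag-G-divisors n)) ⟩
      + 6 * diag-G n + + 6 * 𝒟 n hat-term ∎
    solve-linear : ∀ q f g t5 t3 h → + 16 * q + g ≡ f → + 6 * f + (+ 2 * t5 + + 4 * t3) ≡ + 6 * g + + 6 * h → + 48 * q + (t5 + + 2 * t3) ≡ + 3 * h
    -- Six times `LQ-diagonals` gives twice the wanted equation, so a factor 2 is cancelled.
    solve-linear q f g t5 t3 h refl eq = *-cancelˡ-≡ (+ 2) _ _ (begin
      + 2 * (+ 48 * q + (t5 + + 2 * t3))                                 ≡⟨ expand q g t5 t3 ⟩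
      + 6 * (+ 16 * q + g) + (+ 2 * t5 + + 4 * t3) + - (+ 6 * g)         ≡⟨ cong (_+ - (+ 6 * g)) eq ⟩
      + 6 * g + + 6 * h + - (+ 6 * g)                                    ≡⟨ cancel g h ⟩
      + 2 * (+ 3 * h) ∎)
      where
      expand : ∀ q g t5 t3 → + 2 * (+ 48 * q + (t5 + + 2 * t3)) ≡ + 6 * (+ 16 * q + g) + (+ 2 * t5 + + 4 * t3) + - (+ 6 * g)
      expand = solve-∀
      cancel : ∀ g h → + 6 * g + + 6 * h + - (+ 6 * g) ≡ + 2 * (+ 3 * h)
      cancel = solve-∀

  -- Divisor functions and their convolution

  sumℤ-filter : ∀ {P : ℕ → Set} (P? : Decidable P) (f : ℕ → ℤ) ks →
    sumℤ (map f (filter P? ks)) ≡ sumℤ (map (λ k → if does (P? k) then f k else 0ℤ) ks)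
  sumℤ-filter P? f []       = refl
  sumℤ-filter P? f (k ∷ ks) with P? k
  ... | yes _ = cong (λ z → f k + z) (sumℤ-filter P? f ks)
  ... | no  _ = trans (sumℤ-filter P? f ks) (sym (+-identityˡ _))

  sumℤ-upTo : ∀ n (f : ℕ → ℤ) → sumℤ (map f (upTo n)) ≡ ∑ n (λ k → f (pred k))
  sumℤ-upTo n f = trans (cong sumℤ (map-upTo f n)) (sumℤ-applyUpTo n f)
    where
    sumℤ-applyUpTo : ∀ n (f : ℕ → ℤ) → sumℤ (applyUpTo f n) ≡ ∑ n (λ k → f (pred k))
    sumℤ-applyUpTo zero    f = refl
    sumℤ-applyUpTo (suc n) f = trans
      (cong (λ z → f 0 + z) (trans (sumℤ-applyUpTo n (λ k → f (suc k))) (∑-cong n λ _ → refl)))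
      (sym (∑-head n (λ k → f (pred k))))

  ∑-extend : ∀ {n N} {f : ℕ → ℤ} → n ≤ N → (∀ k → n ≤ k → f (suc k) ≡ 0ℤ) → ∑ n f ≡ ∑ N f
  ∑-extend {n} {N} {f} n≤N vanish with ℕ.≤⇒≤′ n≤N
  ... | ℕ.≤′-reflexive refl  = refl
  ... | ℕ.≤′-step {m} n≤′m = trans (∑-extend {f = f} (ℕ.≤′⇒≤ n≤′m) vanish)
    (sym (trans (cong (λ z → ∑ m f + z) (vanish m (ℕ.≤′⇒≤ n≤′m))) (+-identityʳ _)))

  -- For a divisor `d` exactly one `e` satisfies `d * e = n`, and otherwise none does, so the inner
  -- sum reproduces the filter. The bound `N` may exceed `n`, which lets both factors of the
  -- convolution be summed over a common box.
  divisors-∑ : ∀ {n N} (f : ℕ → ℤ) (φ : ℕ → ℕ → ℤ) → n ≤ N → 0 < n → (∀ d e → suc d ℕ.* suc e ≡ n → f d ≡ φ (suc d) (suc e)) →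
    sumℤ (map f (divisorPreds n)) ≡ ∑ N λ d → ∑ N λ e → δ (d ℕ.* e) n * φ d e
  divisors-∑ {n} {N} f φ n≤N 0<n f≡φ = begin
    sumℤ (map f (divisorPreds n))
      ≡⟨ sumℤ-filter (λ k → suc k ∣? n) f (upTo n) ⟩
    sumℤ (map (λ k → if does (suc k ∣? n) then f k else 0ℤ) (upTo n))
      ≡⟨ sumℤ-upTo n _ ⟩
    ∑ n (λ k → if does (suc (pred k) ∣? n) then f (pred k) else 0ℤ)
      ≡⟨ ∑-cong n (λ d → codivisor d (suc d ∣? n)) ⟩
    (∑ n λ d → ∑ N λ e → δ (d ℕ.* e) n * φ d e)
      ≡⟨ ∑-extend n≤N (λ d n≤d → ∑-zero N λ e → *-vanishˡ (φ (suc d) (suc e))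
           (δ-> (ℕ.<-≤-trans (s≤s n≤d) (ℕ.m≤m*n (suc d) (suc e))))) ⟩
    (∑ N λ d → ∑ N λ e → δ (d ℕ.* e) n * φ d e) ∎
    where
    codivisor : ∀ d (d∣?n : Dec (suc d ∣ n)) → (if does d∣?n then f d else 0ℤ) ≡ ∑ N (λ e → δ (suc d ℕ.* e) n * φ (suc d) e)
    codivisor d (no d∤n) = sym (∑-zero N λ e → *-vanishˡ (φ (suc d) (suc e))
                      (δ-≢ λ de≡n → d∤n (divides (suc e) (trans (sym de≡n) (ℕ.*-comm (suc d) (suc e))))))
    -- A zero quotient would force `n = 0`.
    codivisor d (yes (divides zero    refl)) = contradiction 0<n λ ()
    codivisor d (yes (divides (suc q) n≡qd)) = sym (begin
      ∑ N (λ e → δ (suc d ℕ.* e) n * φ (suc d) e)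
        ≡⟨ ∑-single N q (ℕ.≤-trans (subst (suc q ≤_) (sym n≡qd) (ℕ.m≤m*n (suc q) (suc d))) n≤N)
             (λ e e≢q → *-vanishˡ (φ (suc d) (suc e)) (δ-≢ λ de≡n → e≢q (ℕ.suc-injective
               (ℕ.*-cancelˡ-≡ (suc e) (suc q) (suc d) (trans de≡n (sym dq≡n)))))) ⟩
      δ (suc d ℕ.* suc q) n * φ (suc d) (suc q)
        ≡⟨ cong (_* φ (suc d) (suc q)) (trans (cong (λ k → δ k n) dq≡n) (δ-refl n)) ⟩
      1ℤ * φ (suc d) (suc q)
        ≡⟨ *-identityˡ _ ⟩
      φ (suc d) (suc q)
        ≡⟨ f≡φ d q dq≡n ⟨
      f d ∎)
      where
      dq≡n : suc d ℕ.* suc q ≡ n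
      dq≡n = trans (ℕ.*-comm (suc d) (suc q)) (sym n≡qd)

  σ-tilde-∑ : ∀ s {n N} → n ≤ N → 0 < n → σ-tilde s n ≡ ∑ N λ d → ∑ N λ e → δ (d ℕ.* e) n * tilde-term s d e
  σ-tilde-∑ s n≤N 0<n = divisors-∑ _ (tilde-term s) n≤N 0<n λ _ _ _ → refl

  σ-hat-∑ : ∀ {n N} → n ≤ N → 0 < n → σ-hat n ≡ ∑ N λ d → ∑ N λ e → δ (d ℕ.* e) n * hat-term d e
  σ-hat-∑ n≤N 0<n = divisors-∑ _ hat-term n≤N 0<n λ { d e refl →
    cong (λ q → (-1^ (q ℕ.∸ 1)) * + suc d) (trans (cong (ℕ._/ suc d) (ℕ.*-comm (suc d) (suc e))) (m*n/n≡m (suc e) (suc d))) }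

  ∑²-product : ∀ N (u v : ℕ → ℕ → ℤ) →
    (∑ N λ a → ∑ N λ x → u a x) * (∑ N λ b → ∑ N λ y → v b y) ≡ ∑ N λ a → ∑ N λ b → ∑ N λ x → ∑ N λ y → u a x * v b y
  ∑²-product N u v =
    trans (*-distribʳ-∑ (λ a → ∑ N (u a)) (∑ N λ b → ∑ N (v b))) (∑-cong N λ a →
      trans (*-distribˡ-∑ N (∑ N (u (suc a))) (λ b → ∑ N (v b))) (∑-cong N λ b →
        trans (*-distribʳ-∑ (u (suc a)) (∑ N (v (suc b)))) (∑-cong N λ x →
          *-distribˡ-∑ N (u (suc a) (suc x)) (v (suc b)))))
    where
    *-distribʳ-∑ : ∀ (f : ℕ → ℤ) c → ∑ N f * c ≡ ∑ N (λ k → f k * c)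
    *-distribʳ-∑ f c = trans (*-comm (∑ N f) c) (trans (*-distribˡ-∑ N c f) (∑-cong N λ k → *-comm c (f (suc k))))

  ∑-∑⁴-swap : ∀ m n (h : ℕ → ℕ → ℕ → ℕ → ℕ → ℤ) →
    (∑ m λ i → ∑ n λ a → ∑ n λ b → ∑ n λ x → ∑ n λ y → h i a b x y) ≡
    (∑ n λ a → ∑ n λ b → ∑ n λ x → ∑ n λ y → ∑ m λ i → h i a b x y)
  ∑-∑⁴-swap m n h = trans (∑-swap m n _) (∑-cong n λ a → trans (∑-swap m n _) (∑-cong n λ b →
    trans (∑-swap m n _) (∑-cong n λ x → ∑-swap m n _)))

  -- With both factors expanded, the sum over `i` is moved innermost; there `∑-δ-convolution` merges
  -- the conditions `a x = i` and `b y = n - i` into `a x + b y = n`.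
  convolution : ∀ m → ∑ m (λ i → σ-hat i * σ-tilde 3 (suc m ℕ.∸ i)) ≡ L (suc m) Q
  convolution m = begin
    ∑ m (λ i → σ-hat i * σ-tilde 3 (n ℕ.∸ i))
      ≡⟨ ∑-cong-≤ m (λ i i<m → trans
           (cong₂ _*_ (σ-hat-∑ (s≤s (ℕ.<⇒≤ i<m)) (s≤s z≤n))
                      (σ-tilde-∑ 3 (ℕ.m∸n≤m n (suc i)) (ℕ.m<n⇒0<n∸m i<m)))
           (∑²-product n _ _)) ⟩
    (∑ m λ i → ∑ n λ a → ∑ n λ b → ∑ n λ x → ∑ n λ y →
      δ (a ℕ.* x) i * hat-term a x * (δ (b ℕ.* y) (n ℕ.∸ i) * tilde-term 3 b y))
      ≡⟨ ∑-∑⁴-swap m n _ ⟩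
    (∑ n λ a → ∑ n λ b → ∑ n λ x → ∑ n λ y → ∑ m λ i →
      δ (a ℕ.* x) i * hat-term a x * (δ (b ℕ.* y) (n ℕ.∸ i) * tilde-term 3 b y))
      ≡⟨ ∑⁴-cong n collect ⟩
    L n Q ∎
    where
    n : ℕ
    n = suc m
    -- The exponents `x - 1` and `b - 1` of the divisor functions become `x` and `b` in `Q`; the two
    -- extra minus signs cancel.
    regroup : ∀ p q u v A B → p * (u * A) * (q * (v * (B * (B * (B * 1ℤ))))) ≡ (-1ℤ * u) * (-1ℤ * v) * (A * (B * B * B)) * (p * q)
    regroup = solve-∀
    collect : ∀ a b x y →
      ∑ m (λ i → δ (suc a ℕ.* suc x) i * hat-term (suc a) (suc x) * (δ (suc b ℕ.* suc y) (n ℕ.∸ i) * tilde-term 3 (suc b) (suc y)))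
      ≡ δ (suc a ℕ.* suc x ℕ.+ suc b ℕ.* suc y) n * Q (suc a) (suc b) (suc x) (suc y)
    collect a b x y = begin
      ∑ m (λ i → δ ax i * hat-term (suc a) (suc x) * (δ by (n ℕ.∸ i) * tilde-term 3 (suc b) (suc y)))
        ≡⟨ ∑-cong m (λ i → regroup (δ ax (suc i)) (δ by (m ℕ.∸ i)) (ε x) (ε b) (+ suc a) (+ suc b)) ⟩
      ∑ m (λ i → q * (δ ax i * δ by (n ℕ.∸ i)))
        ≡⟨ *-distribˡ-∑ m q (λ i → δ ax i * δ by (n ℕ.∸ i)) ⟨
      q * ∑ m (λ i → δ ax i * δ by (n ℕ.∸ i))
        ≡⟨ cong (q *_) (∑-δ-convolution m _ _) ⟩
      q * δ (ax ℕ.+ by) n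
        ≡⟨ *-comm q (δ (ax ℕ.+ by) n) ⟩
      δ (ax ℕ.+ by) n * q ∎
      where
      ax by : ℕ
      ax = suc a ℕ.* suc x
      by = suc b ℕ.* suc y
      q : ℤ
      q = Q (suc a) (suc b) (suc x) (suc y)

  -- The claim with its two boundary terms written out: `3 σ-hat n` is the term `i = n` and
  -- `-2 σ-tilde 3 n` the term `i = 0`, leaving an integral identity.
  σ-tilde-5-recurrence : ∀ m → let n = suc m in
    σ-tilde 5 n ≡ + 3 * σ-hat n + - (+ 2) * σ-tilde 3 n + - (+ 48) * ∑ m (λ i → σ-hat i * σ-tilde 3 (n ℕ.∸ i))
  σ-tilde-5-recurrence m = begin
    σ-tilde 5 n
      ≡⟨ isolate s (σ-tilde 5 n) (σ-tilde 3 n) ⟩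
    + 48 * s + (σ-tilde 5 n + + 2 * σ-tilde 3 n) + - (+ 2) * σ-tilde 3 n + - (+ 48) * s
      ≡⟨ cong (λ z → z + - (+ 2) * σ-tilde 3 n + - (+ 48) * s) (begin
        + 48 * s + (σ-tilde 5 n + + 2 * σ-tilde 3 n)
          ≡⟨ cong₂ (λ p q → + 48 * p + q) (convolution m)
               (cong₂ (λ p q → p + + 2 * q) (σ-tilde-∑ 5 {n} ℕ.≤-refl (s≤s z≤n)) (σ-tilde-∑ 3 {n} ℕ.≤-refl (s≤s z≤n))) ⟩
        + 48 * L n Q + (𝒟 n (tilde-term 5) + + 2 * 𝒟 n (tilde-term 3))
          ≡⟨ LQ-divisors n ⟩
        + 3 * 𝒟 n hat-term
          ≡⟨ cong (+ 3 *_) (σ-hat-∑ {n} ℕ.≤-refl (s≤s z≤n)) ⟨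
        + 3 * σ-hat n ∎) ⟩
    + 3 * σ-hat n + - (+ 2) * σ-tilde 3 n + - (+ 48) * s ∎
    where
    n : ℕ
    n = suc m
    s : ℤ
    s = ∑ m (λ i → σ-hat i * σ-tilde 3 (n ℕ.∸ i))
    isolate : ∀ s t₅ t₃ → t₅ ≡ + 48 * s + (t₅ + + 2 * t₃) + - (+ 2) * t₃ + - (+ 48) * s
    isolate = solve-∀

-- Passage to the rationals and the constant terms

open import Data.Rational using (_*_)
open Integral using (∑; ∑-head; σ-tilde-5-recurrence)

ι : ℤ → ℚ
ι z = z / 1

-- Division in `ℚ` normalises by a gcd that is stuck on a variable; among unnormalised fractions the
-- homomorphism laws are plain cross-multiplications.
toℚᵘ-ι : ∀ z → toℚᵘ (ι z) ℚᵘ.≃ mkℚᵘ z 0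
toℚᵘ-ι z = ℚ.toℚᵘ-fromℚᵘ (mkℚᵘ z 0)

ι-homo-+ : ∀ z w → ι (z ℤ.+ w) ≡ ι z ℚ.+ ι w
ι-homo-+ z w = ℚ.toℚᵘ-injective (ℚᵘ.≃-trans (toℚᵘ-ι (z ℤ.+ w)) (ℚᵘ.≃-trans (*≡* (identity z w))
  (ℚᵘ.≃-sym (ℚᵘ.≃-trans (ℚ.toℚᵘ-homo-+ (ι z) (ι w)) (ℚᵘ.+-cong (toℚᵘ-ι z) (toℚᵘ-ι w))))))
  where
  identity : ∀ z w → (z ℤ.+ w) ℤ.* 1ℤ ≡ (z ℤ.* 1ℤ ℤ.+ w ℤ.* 1ℤ) ℤ.* 1ℤ
  identity = solve-∀

ι-homo-* : ∀ z w → ι (z ℤ.* w) ≡ ι z * ι w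
ι-homo-* z w = ℚ.toℚᵘ-injective (ℚᵘ.≃-trans (toℚᵘ-ι (z ℤ.* w)) (ℚᵘ.≃-trans (*≡* refl)
  (ℚᵘ.≃-sym (ℚᵘ.≃-trans (ℚ.toℚᵘ-homo-* (ι z) (ι w)) (ℚᵘ.*-cong (toℚᵘ-ι z) (toℚᵘ-ι w))))))

-- Gathers the inner terms of the convolution into one integer and keeps the last term apart, since
-- that one contains a fractional constant.
sumℚ-snoc-ι : ∀ k (g : ℕ → ℚ) (z : ℕ → ℤ) → (∀ i → i < k → g i ≡ ι (z (suc i))) →
  sumℚ (applyUpTo g (suc k)) ≡ ι (∑ k z) ℚ.+ g k
sumℚ-snoc-ι zero    g z g≡ιz = ℚ.+-comm (g 0) ℚ.0ℚ
sumℚ-snoc-ι (suc k) g z g≡ιz = begin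
  g 0 ℚ.+ sumℚ (applyUpTo (g ∘ suc) (suc k))
    ≡⟨ cong₂ ℚ._+_ (g≡ιz 0 (s≤s z≤n)) (sumℚ-snoc-ι k (g ∘ suc) (z ∘ suc) λ i i<k → g≡ιz (suc i) (s≤s i<k)) ⟩
  ι (z 1) ℚ.+ (ι (∑ k (z ∘ suc)) ℚ.+ g (suc k))
    ≡⟨ ℚ.+-assoc (ι (z 1)) _ _ ⟨
  ι (z 1) ℚ.+ ι (∑ k (z ∘ suc)) ℚ.+ g (suc k)
    ≡⟨ cong (ℚ._+ g (suc k)) (trans (cong ι (∑-head k z)) (ι-homo-+ (z 1) _)) ⟨
  ι (∑ (suc k) z) ℚ.+ g (suc k) ∎

theorem3p1 : (n : ℕ) →
    σ-tilde₅ n ≡ ((- (+ 48)) / 1) * sumℚ (map (uncurry λ i j → σ-hat₁ i * σ-tilde₃ j) (antidiagonal n))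
-- Both sides evaluate to 1/8.
theorem3p1 zero    = refl
theorem3p1 (suc m) = begin
  ι (σ-tilde 5 n)
    ≡⟨ cong ι (σ-tilde-5-recurrence m) ⟩
  ι (+ 3 ℤ.* h ℤ.+ - (+ 2) ℤ.* t ℤ.+ - (+ 48) ℤ.* s)
    ≡⟨ trans (ι-homo-+ (+ 3 ℤ.* h ℤ.+ - (+ 2) ℤ.* t) (- (+ 48) ℤ.* s))
         (cong₂ ℚ._+_ (trans (ι-homo-+ (+ 3 ℤ.* h) (- (+ 2) ℤ.* t)) (cong₂ ℚ._+_ (ι-homo-* (+ 3) h) (ι-homo-* (- (+ 2)) t)))
                      (ι-homo-* (- (+ 48)) s)) ⟩
  ι (+ 3) * ι h ℚ.+ ι (- (+ 2)) * ι t ℚ.+ ι (- (+ 48)) * ι s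
    -- The constant terms enter here: `-48 · 1/24 = -2` and `-48 · (-1/16) = 3`.
    ≡⟨ factor (ι h) (ι t) (ι s) ⟩
  ι (- (+ 48)) * (+ 1 / 24 * ι t ℚ.+ (ι s ℚ.+ ι h * (- (+ 1) / 16)))
    -- The last index pairs `n` with `n ∸ n`, which must be rewritten to 0 before `σ-tilde₃` yields
    -- its constant.
    ≡⟨ cong (λ r → ι (- (+ 48)) * (+ 1 / 24 * ι t ℚ.+ (ι s ℚ.+ ι h * r))) (cong σ-tilde₃ (ℕ.n∸n≡0 n)) ⟨
  ι (- (+ 48)) * (g 0 ℚ.+ (ι s ℚ.+ g n))
    ≡⟨ cong (λ r → ι (- (+ 48)) * (g 0 ℚ.+ r)) (sumℚ-snoc-ι m (g ∘ suc) (λ i → σ-hat i ℤ.* σ-tilde 3 (n ℕ.∸ i)) inner) ⟨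
  ι (- (+ 48)) * sumℚ (applyUpTo g (suc n))
    ≡⟨ cong (λ qs → ι (- (+ 48)) * sumℚ qs) (trans
         (sym (map-∘ {g = uncurry λ i j → σ-hat₁ i * σ-tilde₃ j} {f = λ i → i , n ℕ.∸ i} (upTo (suc n))))
         (map-upTo g (suc n))) ⟨
  ι (- (+ 48)) * sumℚ (map (uncurry λ i j → σ-hat₁ i * σ-tilde₃ j) (antidiagonal n)) ∎
  where
  n : ℕ
  n = suc m
  h t s : ℤ
  h = σ-hat n
  t = σ-tilde 3 n
  s = ∑ m (λ i → σ-hat i ℤ.* σ-tilde 3 (n ℕ.∸ i))
  g : ℕ → ℚ
  g i = σ-hat₁ i * σ-tilde₃ (n ℕ.∸ i)
  σ-tilde₃-positive : ∀ {j} → 0 < j → σ-tilde₃ j ≡ ι (σ-tilde 3 j)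
  σ-tilde₃-positive (s≤s _) = refl
  inner : ∀ i → i < m → g (suc i) ≡ ι (σ-hat (suc i) ℤ.* σ-tilde 3 (m ℕ.∸ i))
  inner i i<m = trans (cong (ι (σ-hat (suc i)) *_) (σ-tilde₃-positive (ℕ.m<n⇒0<n∸m i<m)))
    (sym (ι-homo-* (σ-hat (suc i)) (σ-tilde 3 (m ℕ.∸ i))))
  factor : ∀ x y z →
    ι (+ 3) * x ℚ.+ ι (- (+ 2)) * y ℚ.+ ι (- (+ 48)) * z ≡
    ι (- (+ 48)) * (+ 1 / 24 * y ℚ.+ (z ℚ.+ x * (- (+ 1) / 16)))
  factor = solve 3 (λ x y z →
    con (ι (+ 3)) :* x :+ con (ι (- (+ 2))) :* y :+ con (ι (- (+ 48))) :* z :=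
    con (ι (- (+ 48))) :* (con (+ 1 / 24) :* y :+ (z :+ x :* con (- (+ 1) / 16)))) refl
    where open +-*-Solver
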